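{- A cubic algebra $\mathcal L$ has a g-cover if and only if $\mathcal L$ is isomorphic (as a cubic algebra) to $\mathsf I(\mathcal I)$ for some implication algebra $\mathcal I$.
   Context: A cubic algebra is a join-semilattice $\mathcal L$ with top $\mathbf 1$ and a binary operation $\Delta$ such that: if $x\le y$ then $\Delta(y,x)\vee x=y$; if $x\le y\le z$ then $\Delta(z,\Delta(y,x))=\Delta(\Delta(z,y),\Delta(z,x))$; if $x\le y$ then $\Delta(y,\Delta(y,x))=x$; if $x\le y\le z$ then $\Delta(z,x)\le\Delta(z,y)$; and with $xy:=\Delta(\mathbf 1,\Delta(x\vee y,y))\vee y$ one has $(xy)y=x\vee y$ and $x(yz)=y(xz)$. With the operation $xy$, $\mathcal L$ is an implication algebra; an implication subalgebra is a subset closed under this operation. For $a,b\in\mathcal L$, $a\sim b$ iff $\Delta(a\vee b,a)=b$; $\sim$ is an equivalence relation and $\mathcal L/\!\sim$ is an implication algebra with order $[a]\le[b]$ iff $\Delta(a\vee b,a)\le b$, join $[a]\vee[b]=[a\vee\Delta(a\vee b,b)]$ and implication $[a]\to[b]=[\Delta(a\vee b,a)\,b]$. Let $\eta\colon\mathcal L\to\mathcal L/\!\sim$ be the quotient map. A g-cover of $\mathcal L$ is an upwards-closed implication subalgebra $J\subseteq\mathcal L$ such that the restriction $\eta|_J\colon J\to\mathcal L/\!\sim$ is an isomorphism of implication algebras. An implication algebra is a join-semilattice with top in which every interval $[a,\mathbf 1]$ is Boolean, with $x\to y$ the complement of $x\vee y$ in $[y,\mathbf 1]$. For an implication algebra $\mathcal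 I$, $\mathsf I(\mathcal I)=\{\langle a,b\rangle : a\vee b=\mathbf 1,\ a\wedge b\text{ exists}\}$ ordered componentwise, with componentwise join, top $\langle\mathbf 1,\mathbf 1\rangle$ and, for $\langle c,d\rangle\le\langle a,b\rangle$, $\Delta(\langle a,b\rangle,\langle c,d\rangle)=\langle a\wedge(b\to d),b\wedge(a\to c)\rangle$; it is a cubic algebra. -}

module Defs where

open import Level using (Level; _⊔_) renaming (suc to lsuc)
open import Relation.Binary.Core using (Rel)
open import Relation.Binary.Structures using (IsEquivalence)
open import Relation.Unary using (Pred)
open import Data.Product using (Σ; _×_; _,_)

record JoinSemilatticeTop (c ℓ : Level) : Set (lsuc (c ⊔ ℓ)) where
  infix  4 _≈_ _≤_
  infixr 6 _∨_
  field
    Carrier       : Set c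
    _≈_           : Rel Carrier ℓ
    isEquivalence : IsEquivalence _≈_
    _∨_           : Carrier → Carrier → Carrier
    𝟏             : Carrier
    ∨-cong        : ∀ {x x′ y y′} → x ≈ x′ → y ≈ y′ → (x ∨ y) ≈ (x′ ∨ y′)
    ∨-assoc       : ∀ x y z → ((x ∨ y) ∨ z) ≈ (x ∨ (y ∨ z))
    ∨-comm        : ∀ x y → (x ∨ y) ≈ (y ∨ x)
    ∨-idem        : ∀ x → (x ∨ x) ≈ x
    ∨-top         : ∀ x → (x ∨ 𝟏) ≈ 𝟏

  _≤_ : Rel Carrier ℓ
  x ≤ y = (x ∨ y) ≈ y

  IsGLB : Carrier → Carrier → Carrier → Set (c ⊔ ℓ)
  IsGLB m x y = m ≤ x × m ≤ y × (∀ z → z ≤ x → z ≤ y → z ≤ m)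

  MeetExists : Carrier → Carrier → Set (c ⊔ ℓ)
  MeetExists x y = Σ Carrier λ m → IsGLB m x y

-- Implication algebras: join-semilattice with top in which every
-- interval [a,𝟏] is Boolean, and x ⇒ y is the complement of x ∨ y in [y,𝟏].

record ImplicationAlgebra (c ℓ : Level) : Set (lsuc (c ⊔ ℓ)) where
  field
    joinSemilatticeTop : JoinSemilatticeTop c ℓ
  open JoinSemilatticeTop joinSemilatticeTop public
  infixr 5 _⇒_
  field
    _⇒_    : Carrier → Carrier → Carrier
    ⇒-cong : ∀ {x x′ y y′} → x ≈ x′ → y ≈ y′ → (x ⇒ y) ≈ (x′ ⇒ y′)
    -- [a,𝟏] is a lattice: meets of elements of [a,𝟏] exist
    -- (joins and top are inherited, and [a,𝟏] is closed under them)
    interval-meet       : ∀ a x y → a ≤ x → a ≤ y → MeetExists x y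
    interval-distrib    : ∀ a x y z → a ≤ x → a ≤ y → a ≤ z →
                          ∀ m₁ m₂ m₃ → IsGLB m₁ x (y ∨ z) → IsGLB m₂ x y →
                          IsGLB m₃ x z → m₁ ≈ (m₂ ∨ m₃)
    interval-complement : ∀ a x → a ≤ x →
                          Σ Carrier λ x′ → a ≤ x′ × (x ∨ x′) ≈ 𝟏 × IsGLB a x x′
    ⇒-in-interval : ∀ x y → y ≤ (x ⇒ y)
    ⇒-join        : ∀ x y → ((x ∨ y) ∨ (x ⇒ y)) ≈ 𝟏
    ⇒-meet        : ∀ x y → IsGLB y (x ∨ y) (x ⇒ y)

-- Cubic algebras.  Δ is modelled as a total binary operation; the axioms
-- (and everything below) only use Δ y x for x ≤ y.

record CubicAlgebra (c ℓ : Level) : Set (lsuc (c ⊔ ℓ)) where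
  field
    joinSemilatticeTop : JoinSemilatticeTop c ℓ
  open JoinSemilatticeTop joinSemilatticeTop public
  field
    Δ      : Carrier → Carrier → Carrier
    Δ-cong : ∀ {x x′ y y′} → x ≈ x′ → y ≈ y′ → Δ x y ≈ Δ x′ y′
    Δ-ax1  : ∀ {x y} → x ≤ y → (Δ y x ∨ x) ≈ y
    Δ-ax2  : ∀ {x y z} → x ≤ y → y ≤ z → Δ z (Δ y x) ≈ Δ (Δ z y) (Δ z x)
    Δ-ax3  : ∀ {x y} → x ≤ y → Δ y (Δ y x) ≈ x
    Δ-ax4  : ∀ {x y z} → x ≤ y → y ≤ z → Δ z x ≤ Δ z y

  infixl 7 _·_
  _·_ : Carrier → Carrier → Carrier
  x · y = Δ 𝟏 (Δ (x ∨ y) y) ∨ y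

  field
    ·-ax1 : ∀ x y → ((x · y) · y) ≈ (x ∨ y)
    ·-ax2 : ∀ x y z → (x · (y · z)) ≈ (y · (x · z))

  infix 4 _∼_
  _∼_ : Rel Carrier ℓ
  a ∼ b = Δ (a ∨ b) a ≈ b

-- g-covers.  L/∼ is represented as the setoid (Carrier, _∼_), η is the
-- identity on carriers, and [a] → [b] = [Δ(a ∨ b, a) b].

record GCover {c ℓ : Level} (L : CubicAlgebra c ℓ) : Set (lsuc ℓ ⊔ c) where
  open CubicAlgebra L
  field
    J        : Pred Carrier ℓ
    J-resp   : ∀ {x y} → x ≈ y → J x → J y
    J-upward : ∀ {x y} → J x → x ≤ y → J y
    J-·      : ∀ {x y} → J x → J y → J (x · y)
    -- η|J : J → L/∼ is an isomorphism of implication algebras: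
    -- a homomorphism for the implications ...
    η-hom    : ∀ {x y} → J x → J y → (x · y) ∼ (Δ (x ∨ y) x · y)
    η-inj    : ∀ {x y} → J x → J y → x ∼ y → x ≈ y
    η-surj   : ∀ a → Σ Carrier λ x → J x × x ∼ a

module _ {c ℓ : Level} (𝓘 : ImplicationAlgebra c ℓ) where
  open ImplicationAlgebra 𝓘

  record IPair : Set (c ⊔ ℓ) where
    field
      fst        : Carrier
      snd        : Carrier
      join-top : (fst ∨ snd) ≈ 𝟏
      meet     : MeetExists fst snd

  _≈ᴵ_ : IPair → IPair → Set ℓ
  p ≈ᴵ q = (IPair.fst p ≈ IPair.fst q) × (IPair.snd p ≈ IPair.snd q)

-- An isomorphism of cubic algebras  L ≅ I(𝓘):  a bijection preserving
-- ∨, 𝟏 and Δ  (Δ(⟨a,b⟩,⟨c,d⟩) = ⟨a ∧ (b → d), b ∧ (a → c)⟩ for ⟨c,d⟩ ≤ ⟨a,b⟩,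
-- stated through meets since meets are only determined up to ≈).

record CubicIsoToI {c ℓ : Level} (L : CubicAlgebra c ℓ)
                   (𝓘 : ImplicationAlgebra c ℓ) : Set (c ⊔ ℓ) where
  module L = CubicAlgebra L
  module I = ImplicationAlgebra 𝓘
  open IPair
  field
    f       : L.Carrier → IPair 𝓘
    f-cong  : ∀ {x y} → x L.≈ y → _≈ᴵ_ 𝓘 (f x) (f y)
    f-inj   : ∀ {x y} → _≈ᴵ_ 𝓘 (f x) (f y) → x L.≈ y
    f-surj  : ∀ p → Σ L.Carrier λ x → _≈ᴵ_ 𝓘 (f x) p
    f-∨     : ∀ x y → (fst (f (x L.∨ y)) I.≈ (fst (f x) I.∨ fst (f y))) ×
                      (snd (f (x L.∨ y)) I.≈ (snd (f x) I.∨ snd (f y)))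
    f-𝟏     : (fst (f L.𝟏) I.≈ I.𝟏) × (snd (f L.𝟏) I.≈ I.𝟏)
    f-Δ     : ∀ {x y} → x L.≤ y →
              I.IsGLB (fst (f (L.Δ y x))) (fst (f y)) (snd (f y) I.⇒ snd (f x)) ×
              I.IsGLB (snd (f (L.Δ y x))) (snd (f y)) (fst (f y) I.⇒ fst (f x))

{-# OPTIONS --safe #-}

-- From an isomorphism L ≅ I(𝓘), the elements ⟨a,𝟏⟩ form a g-cover.
--
-- Conversely let J be a g-cover and let j x be the element of J equivalent
-- to x.  Then x corresponds to ⟨x ∨ j x , Δ(𝟏,x) ∨ j x⟩: the first entry is the
-- least element of J above x, and the second is the least element of J above
-- Δ(𝟏,x), so both entries preserve joins.  Leastness comes from the fact that
-- a ∼ w ≤ z implies a ≤ Δ(z ∨ a , z) ∼ z, together with injectivity of η on J.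
-- Once j (Δ(y,x)) = j x is known, the formula for Δ is forced by the join
-- Δ(y,x) ∨ x = y in the Boolean interval above j x.

module Submission where

open import Defs
open import Level using (Level)
open import Data.Product using (Σ; _×_; _,_; proj₁; proj₂)
open import Function.Bundles using (_⇔_; mk⇔)
open import Relation.Binary.Bundles using (Poset)
open import Relation.Binary.Structures using (IsEquivalence)
import Relation.Binary.Reasoning.PartialOrder as PosetReasoning

-- Order and meets in a join-semilattice with top.

module JoinSemilatticeProperties {c ℓ : Level} (S : JoinSemilatticeTop c ℓ) where
  open JoinSemilatticeTop S
  open IsEquivalence isEquivalence public using (refl; sym; trans)

  ≤-reflexive : ∀ {x y} → x ≈ y → x ≤ y
  ≤-reflexive {x} {y} e = trans (∨-cong e refl) (∨-idem y)

  ≤-refl : ∀ {x} → x ≤ x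
  ≤-refl {x} = ∨-idem x

  ≤-trans : ∀ {x y z} → x ≤ y → y ≤ z → x ≤ z
  ≤-trans {x} {y} {z} p q =
    trans (∨-cong refl (sym q)) (trans (sym (∨-assoc x y z)) (trans (∨-cong p refl) q))

  ≤-antisym : ∀ {x y} → x ≤ y → y ≤ x → x ≈ y
  ≤-antisym {x} {y} p q = trans (sym q) (trans (∨-comm y x) p)

  poset : Poset c ℓ ℓ
  poset = record
    { Carrier = Carrier ; _≈_ = _≈_ ; _≤_ = _≤_
    ; isPartialOrder = record
      { isPreorder = record
        { isEquivalence = isEquivalence ; reflexive = ≤-reflexive ; trans = ≤-trans }
      ; antisym = ≤-antisym } }

  module ≤-Reasoning = PosetReasoning poset

  ≤-resp : ∀ {x x′ y y′} → x ≈ x′ → y ≈ y′ → x ≤ y → x′ ≤ y′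
  ≤-resp e f p = ≤-trans (≤-reflexive (sym e)) (≤-trans p (≤-reflexive f))

  x≤𝟏 : ∀ {x} → x ≤ 𝟏
  x≤𝟏 {x} = ∨-top x

  x≤x∨y : ∀ {x y} → x ≤ (x ∨ y)
  x≤x∨y {x} {y} = trans (sym (∨-assoc x x y)) (∨-cong (∨-idem x) refl)

  y≤x∨y : ∀ {x y} → y ≤ (x ∨ y)
  y≤x∨y {x} {y} = ≤-trans x≤x∨y (≤-reflexive (∨-comm y x))

  ∨-least : ∀ {x y z} → x ≤ z → y ≤ z → (x ∨ y) ≤ z
  ∨-least {x} {y} {z} p q = trans (∨-assoc x y z) (trans (∨-cong refl q) p)

  ∨-mono : ∀ {x x′ y y′} → x ≤ x′ → y ≤ y′ → (x ∨ y) ≤ (x′ ∨ y′)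
  ∨-mono p q = ∨-least (≤-trans p x≤x∨y) (≤-trans q y≤x∨y)

  ∨-absorb : ∀ {x y} → y ≤ x → (x ∨ y) ≈ x
  ∨-absorb p = trans (∨-comm _ _) p

  𝟏≤⇒≈𝟏 : ∀ {x} → 𝟏 ≤ x → x ≈ 𝟏
  𝟏≤⇒≈𝟏 p = ≤-antisym x≤𝟏 p

  IsGLB-unique : ∀ {m n x y} → IsGLB m x y → IsGLB n x y → m ≈ n
  IsGLB-unique (a , b , g) (a′ , b′ , g′) = ≤-antisym (g′ _ a b) (g _ a′ b′)

  IsGLB-resp : ∀ {m m′ x x′ y y′} → m ≈ m′ → x ≈ x′ → y ≈ y′ → IsGLB m x y → IsGLB m′ x′ y′
  IsGLB-resp e f h (a , b , g) =
    ≤-resp e f a , ≤-resp e h b ,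
    λ z p q → ≤-resp refl e (g z (≤-resp refl (sym f) p) (≤-resp refl (sym h) q))

  IsGLB-comm : ∀ {m x y} → IsGLB m x y → IsGLB m y x
  IsGLB-comm (a , b , g) = b , a , λ z p q → g z q p

  ≤⇒IsGLB : ∀ {x y} → x ≤ y → IsGLB x x y
  ≤⇒IsGLB p = ≤-refl , p , λ z q _ → q

-- Complements in Boolean intervals.

module ImplicationAlgebraProperties {c ℓ : Level} (𝓘 : ImplicationAlgebra c ℓ) where
  open ImplicationAlgebra 𝓘
  open JoinSemilatticeProperties joinSemilatticeTop public

  x⇒x≈𝟏 : ∀ x → (x ⇒ x) ≈ 𝟏
  x⇒x≈𝟏 x = trans (sym (≤-trans (≤-reflexive (∨-idem x)) (⇒-in-interval x x))) (⇒-join x x)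

  -- Distributing `y` over `x ∨ y′ = 𝟏` gives `y = m ∨ (y ∧ y′)`, and both terms lie below `y′`.
  -- Used in both directions it yields uniqueness of complements.
  complement-≤ : ∀ {m x y y′} → IsGLB m x y → IsGLB m x y′ → (x ∨ y′) ≈ 𝟏 → y ≤ y′
  complement-≤ {m} {x} {y} {y′} g@(m≤x , m≤y , _) (_ , m≤y′ , _) e
    with interval-meet m y y′ m≤y m≤y′
  ... | n , h@(_ , n≤y′ , _) = begin
    y      ≈⟨ interval-distrib m y x y′ m≤y m≤x m≤y′ y m n
                (IsGLB-resp refl refl (sym e) (≤⇒IsGLB x≤𝟏)) (IsGLB-comm g) h ⟩
    m ∨ n  ≤⟨ ∨-least m≤y′ n≤y′ ⟩
    y′     ∎
    where open ≤-Reasoning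

  ⇒-complement : ∀ {m x y} → (x ∨ y) ≈ 𝟏 → IsGLB m x y → (x ⇒ m) ≈ y
  ⇒-complement {m} {x} {y} e g@(m≤x , _) = ≤-antisym (complement-≤ h g e) (complement-≤ g h t)
    where
    h : IsGLB m x (x ⇒ m)
    h = IsGLB-resp refl (∨-absorb m≤x) refl (⇒-meet x m)
    t : (x ∨ (x ⇒ m)) ≈ 𝟏
    t = trans (∨-cong (sym (∨-absorb m≤x)) refl) (⇒-join x m)

-- Reflections, implication and interval meets in a cubic algebra.

module CubicAlgebraProperties {c ℓ : Level} (L : CubicAlgebra c ℓ) where
  open CubicAlgebra L
  open JoinSemilatticeProperties joinSemilatticeTop public

  Δ≤ : ∀ {x y} → x ≤ y → Δ y x ≤ y
  Δ≤ p = ≤-trans x≤x∨y (≤-reflexive (Δ-ax1 p))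

  -- `Δ m` is a monotone involution below `m`, hence its own adjoint on either side.
  Δ-swap-≤ : ∀ {m x y} → x ≤ m → y ≤ m → Δ m x ≤ y → x ≤ Δ m y
  Δ-swap-≤ p q r = ≤-resp (Δ-ax3 p) refl (Δ-ax4 r q)

  Δ-swap-≥ : ∀ {m x y} → x ≤ m → y ≤ m → x ≤ Δ m y → Δ m x ≤ y
  Δ-swap-≥ p q r = ≤-resp refl (Δ-ax3 q) (Δ-ax4 r (Δ≤ q))

  Δxx≈x : ∀ {x} → Δ x x ≈ x
  Δxx≈x = ≤-antisym (Δ≤ ≤-refl) (≤-resp (Δ-ax3 ≤-refl) refl (Δ-ax4 (Δ≤ ≤-refl) ≤-refl))

  Δ𝟏-∨ : ∀ x y → Δ 𝟏 (x ∨ y) ≈ (Δ 𝟏 x ∨ Δ 𝟏 y)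
  Δ𝟏-∨ x y = ≤-antisym
    (Δ-swap-≥ x≤𝟏 x≤𝟏 (∨-least (Δ-swap-≤ x≤𝟏 x≤𝟏 x≤x∨y) (Δ-swap-≤ x≤𝟏 x≤𝟏 y≤x∨y)))
    (∨-least (Δ-ax4 x≤x∨y x≤𝟏) (Δ-ax4 y≤x∨y x≤𝟏))

  ·-cong : ∀ {x x′ y y′} → x ≈ x′ → y ≈ y′ → (x · y) ≈ (x′ · y′)
  ·-cong e f = ∨-cong (Δ-cong refl (Δ-cong (∨-cong e f) f)) f

  y≤x·y : ∀ {x y} → y ≤ (x · y)
  y≤x·y = y≤x∨y

  ·-∨ : ∀ {x x′ y} → (x ∨ y) ≈ (x′ ∨ y) → (x · y) ≈ (x′ · y)
  ·-∨ e = ∨-cong (Δ-cong refl (Δ-cong e refl)) refl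

  x∨x·y≈𝟏 : ∀ {x y} → (x ∨ x · y) ≈ 𝟏
  x∨x·y≈𝟏 {x} {y} = 𝟏≤⇒≈𝟏 (begin
    𝟏                                    ≈⟨ Δ-ax1 x≤𝟏 ⟨
    Δ 𝟏 (Δ (x ∨ y) y) ∨ Δ (x ∨ y) y      ≤⟨ ∨-mono x≤x∨y (Δ≤ y≤x∨y) ⟩
    x · y ∨ (x ∨ y)                      ≤⟨ ∨-least y≤x∨y (∨-least x≤x∨y (≤-trans y≤x·y y≤x∨y)) ⟩
    x ∨ x · y                            ∎)
    where open ≤-Reasoning

  ∨≈𝟏⇒x·y≈y : ∀ {x y} → (x ∨ y) ≈ 𝟏 → (x · y) ≈ y
  ∨≈𝟏⇒x·y≈y {x} {y} e =
    trans (∨-cong (trans (Δ-cong refl (Δ-cong e refl)) (Δ-ax3 x≤𝟏)) refl) (∨-idem y)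

  ≤⇒·≈𝟏 : ∀ {x y} → x ≤ y → (x · y) ≈ 𝟏
  ≤⇒·≈𝟏 p = trans (∨-cong (Δ-cong refl (trans (Δ-cong p refl) Δxx≈x)) refl) (Δ-ax1 x≤𝟏)

  ·≈𝟏⇒≤ : ∀ {x y} → (x · y) ≈ 𝟏 → x ≤ y
  ·≈𝟏⇒≤ {x} {y} e = trans (sym (·-ax1 x y))
    (trans (·-cong e refl) (∨≈𝟏⇒x·y≈y (∨-absorb x≤𝟏)))

  -- Exchange, read through `x · y ≈ 𝟏` iff `x ≤ y`: the map `_· z` forms a Galois connection with
  -- itself.
  ·-swap : ∀ {x y z} → x ≤ (y · z) → y ≤ (x · z)
  ·-swap p = ·≈𝟏⇒≤ (trans (·-ax2 _ _ _) (≤⇒·≈𝟏 p))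

  ·-antiˡ : ∀ {x y z} → x ≤ y → (y · z) ≤ (x · z)
  ·-antiˡ {x} {y} {z} p = ·-swap (≤-trans p (≤-trans x≤x∨y (≤-reflexive (sym (·-ax1 y z)))))

  ·-monoʳ : ∀ {x y z} → y ≤ z → (x · y) ≤ (x · z)
  ·-monoʳ {x} {y} {z} p = begin
    x · y              ≤⟨ y≤x·y ⟩
    (z · y) · (x · y)  ≈⟨ ·-ax2 x (z · y) y ⟨
    x · ((z · y) · y)  ≈⟨ ·-cong refl (trans (·-ax1 z y) (∨-absorb p)) ⟩
    x · z              ∎
    where open ≤-Reasoning

  -- A common lower bound `z` satisfies `z ≤ (x · y) · y ≤ z · y`, so `z · y = z ∨ z · y = 𝟏`.
  ·-glb : ∀ x y → IsGLB y (x ∨ y) (x · y)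
  ·-glb x y = y≤x∨y , y≤x·y , λ z p q → ·≈𝟏⇒≤ (trans
    (sym (≤-trans p (≤-trans (≤-reflexive (sym (·-ax1 x y))) (·-antiˡ q))))
    x∨x·y≈𝟏)

  -- In the Boolean interval [a,𝟏] this is ¬(x → ¬y).
  meetAbove : Carrier → Carrier → Carrier → Carrier
  meetAbove a x y = (x · (y · a)) · a

  -- Write `n` for `meetAbove a x y`. A common lower bound of `x` and `y` is then below both `x ∨ n`
  -- and `x · n`, hence below `n` by `·-glb`.
  ≤·meetAbove : ∀ {a x y} → y ≤ (x · meetAbove a x y)
  ≤·meetAbove {a} {x} {y} = ·≈𝟏⇒≤ (begin-equality
    y · (x · ((x · (y · a)) · a))  ≈⟨ ·-cong refl (·-ax2 x (x · (y · a)) a) ⟩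
    y · ((x · (y · a)) · (x · a))  ≈⟨ ·-ax2 y (x · (y · a)) (x · a) ⟩
    (x · (y · a)) · (y · (x · a))  ≈⟨ ≤⇒·≈𝟏 (≤-reflexive (·-ax2 x y a)) ⟩
    𝟏                              ∎)
    where
    open ≤-Reasoning

  meetAbove-glb : ∀ {a x y} → a ≤ x → a ≤ y → IsGLB (meetAbove a x y) x y
  meetAbove-glb {a} {x} {y} p q = n≤x , n≤y , λ z z≤x z≤y →
    proj₂ (proj₂ (·-glb x n)) z (≤-trans z≤x x≤x∨y) (≤-trans z≤y ≤·meetAbove)
    where
    n = meetAbove a x y
    n≤x : n ≤ x
    n≤x = ≤-trans (·-antiˡ (·-monoʳ y≤x·y)) (≤-reflexive (trans (·-ax1 x a) (∨-absorb p)))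
    n≤y : n ≤ y
    n≤y = ≤-trans (·-antiˡ y≤x·y) (≤-reflexive (trans (·-ax1 y a) (∨-absorb q)))

  -- The relation `∼` and its interaction with reflections.

  ∼-refl : ∀ {x} → x ∼ x
  ∼-refl = trans (Δ-cong (∨-idem _) refl) Δxx≈x

  ∼-sym : ∀ {x y} → x ∼ y → y ∼ x
  ∼-sym {x} {y} e = trans (Δ-cong (∨-comm y x) (sym e)) (Δ-ax3 x≤x∨y)

  ∼-respʳ : ∀ {x y y′} → y ≈ y′ → x ∼ y → x ∼ y′
  ∼-respʳ e p = trans (Δ-cong (∨-cong refl (sym e)) refl) (trans p e)

  x∼Δyx : ∀ {x y} → x ≤ y → x ∼ Δ y x
  x∼Δyx p = Δ-cong (trans (∨-comm _ _) (Δ-ax1 p)) refl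

  -- For `x ≤ y`, `y · x` is `Δ 𝟏 (Δ y x) ∨ x`, so `Δ 𝟏` merely exchanges the roles of `x` and
  -- `Δ y x`.
  Δ𝟏-· : ∀ {x y} → x ≤ y → Δ 𝟏 (y · x) ≈ (y · Δ y x)
  Δ𝟏-· {x} {y} p = begin-equality
    Δ 𝟏 (Δ 𝟏 (Δ (y ∨ x) x) ∨ x)                ≈⟨ Δ𝟏-∨ _ _ ⟩
    Δ 𝟏 (Δ 𝟏 (Δ (y ∨ x) x)) ∨ Δ 𝟏 x            ≈⟨ ∨-cong (Δ-ax3 x≤𝟏) refl ⟩
    Δ (y ∨ x) x ∨ Δ 𝟏 x                        ≈⟨ ∨-cong (Δ-cong (∨-absorb p) refl) refl ⟩
    Δ y x ∨ Δ 𝟏 x                              ≈⟨ ∨-comm _ _ ⟩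
    Δ 𝟏 x ∨ Δ y x                              ≈⟨ ∨-cong (Δ-cong refl x≈) refl ⟩
    Δ 𝟏 (Δ (y ∨ Δ y x) (Δ y x)) ∨ Δ y x        ∎
    where
    open ≤-Reasoning
    x≈ : x ≈ Δ (y ∨ Δ y x) (Δ y x)
    x≈ = sym (trans (Δ-cong (∨-absorb (Δ≤ p)) refl) (Δ-ax3 p))

  -- `Δ y x` is the meet of `y` and `y · Δ y x`. This turns bounds by a reflection into inequalities
  -- between implications.
  ≤Δ : ∀ {t x y} → x ≤ y → t ≤ y → t ≤ Δ 𝟏 (y · x) → t ≤ Δ y x
  ≤Δ {t} {x} {y} p q r =
    proj₂ (proj₂ (·-glb y (Δ y x))) t (≤-trans q x≤x∨y) (≤-trans r (≤-reflexive (Δ𝟏-· p)))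

  -- Since `a` is the reflection of `w` in `w ∨ a`, `Δ𝟏-·` bounds it by `Δ 𝟏 ((w ∨ a) · w)`, where
  -- `w` can be raised to `z`. An implication depends on its left argument only through the join
  -- with the right one, so `w ∨ a` may become `z ∨ a`.
  ∼-≤⇒≤Δ : ∀ {a w z} → a ∼ w → w ≤ z → a ≤ Δ (z ∨ a) z
  ∼-≤⇒≤Δ {a} {w} {z} e w≤z = ≤Δ x≤x∨y y≤x∨y (begin
    a                        ≤⟨ y≤x·y ⟩
    (w ∨ a) · a              ≈⟨ ·-cong refl (∼-sym e) ⟨
    (w ∨ a) · Δ (w ∨ a) w    ≈⟨ Δ𝟏-· x≤x∨y ⟨
    Δ 𝟏 ((w ∨ a) · w)        ≤⟨ Δ-ax4 (·-monoʳ w≤z) x≤𝟏 ⟩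
    Δ 𝟏 ((w ∨ a) · z)        ≈⟨ Δ-cong refl (·-∨ join≈) ⟩
    Δ 𝟏 ((z ∨ a) · z)        ∎)
    where
    open ≤-Reasoning
    join≈ : ((w ∨ a) ∨ z) ≈ ((z ∨ a) ∨ z)
    join≈ = ≤-antisym
      (∨-least (≤-trans (∨-mono w≤z ≤-refl) x≤x∨y) y≤x∨y)
      (∨-least (∨-least y≤x∨y (≤-trans y≤x∨y x≤x∨y)) y≤x∨y)

  -- (m · p) · w is the complement of p in the interval [w,m].
  ΔΔ≤relativeComplement : ∀ {w p m} → w ≤ p → p ≤ m → Δ m (Δ p w) ≤ ((m · p) · w)
  ΔΔ≤relativeComplement {w} {p} {m} w≤p p≤m =
    -- Here `a ∼ w ≤ q`, so `a` lies below the reflection of `q` in `q ∨ a`, and that join is `m`.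
    Δ-swap-≥ a≤m q≤m (≤-resp refl (Δ-cong q∨a≈m refl) (∼-≤⇒≤Δ (∼-sym (x∼Δyx w≤p)) y≤x·y))
    where
    open ≤-Reasoning
    q = (m · p) · w
    a≤m : Δ p w ≤ m
    a≤m = ≤-trans (Δ≤ w≤p) p≤m
    q≤m : q ≤ m
    q≤m = begin
      (m · p) · w  ≤⟨ ·-monoʳ w≤p ⟩
      (m · p) · p  ≈⟨ ·-ax1 m p ⟩
      m ∨ p        ≈⟨ ∨-absorb p≤m ⟩
      m            ∎
    q·p≤m·p : (q · p) ≤ (m · p)
    q·p≤m·p = begin
      q · p        ≤⟨ ·-monoʳ y≤x·y ⟩
      q · (m · p)  ≈⟨ ∨≈𝟏⇒x·y≈y (trans (∨-comm _ _) x∨x·y≈𝟏) ⟩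
      m · p        ∎
    m≤q∨a : m ≤ (q ∨ Δ p w)
    m≤q∨a = begin
      m                ≤⟨ x≤x∨y ⟩
      m ∨ p            ≈⟨ ·-ax1 m p ⟨
      (m · p) · p      ≤⟨ ·-antiˡ q·p≤m·p ⟩
      (q · p) · p      ≈⟨ ·-ax1 q p ⟩
      q ∨ p            ≈⟨ ∨-cong refl (Δ-ax1 w≤p) ⟨
      q ∨ (Δ p w ∨ w)  ≤⟨ ∨-least x≤x∨y (∨-least y≤x∨y (≤-trans y≤x·y x≤x∨y)) ⟩
      q ∨ Δ p w        ∎
    q∨a≈m : (q ∨ Δ p w) ≈ m
    q∨a≈m = ≤-antisym (∨-least q≤m a≤m) m≤q∨a

  -- By `≤Δ` and the involution `Δ 𝟏` it suffices to bound `Δ 𝟏 (Δ m a)` by `(Δ m a ∨ w) · w`. It is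
  -- below `m · p`, and exchange applies because `Δ m a` and `w` both lie below `(m · p) · w`.
  ΔΔ≤Δ : ∀ {w p m} → w ≤ p → p ≤ m → Δ m (Δ p w) ≤ Δ (Δ m (Δ p w) ∨ w) w
  ΔΔ≤Δ {w} {p} {m} w≤p p≤m = ≤Δ y≤x∨y x≤x∨y (Δ-swap-≤ x≤𝟏 x≤𝟏 (begin
    Δ 𝟏 (Δ m a)            ≈⟨ Δ-cong refl (Δ-cong (∨-absorb a≤m) refl) ⟨
    Δ 𝟏 (Δ (m ∨ a) a)      ≤⟨ x≤x∨y ⟩
    m · a                  ≤⟨ ·-monoʳ (Δ≤ w≤p) ⟩
    m · p                  ≤⟨ ·-swap (∨-least (ΔΔ≤relativeComplement w≤p p≤m) y≤x·y) ⟩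
    (Δ m a ∨ w) · w        ∎))
    where
    open ≤-Reasoning
    a = Δ p w
    a≤m : a ≤ m
    a≤m = ≤-trans (Δ≤ w≤p) p≤m

  -- Put q = Δ m (Δ p w) ∨ w.  By ΔΔ≤Δ it remains to see Δ q w ≤ Δ m (Δ p w); since
  -- p and q are complements in [w,m], this is ΔΔ≤Δ for q, whose own q is p.
  ∼ΔΔ : ∀ {w p m} → w ≤ p → p ≤ m → w ∼ Δ m (Δ p w)
  ∼ΔΔ {w} {p} {m} w≤p p≤m =
    trans (Δ-cong (∨-comm _ _) refl)
      (≤-antisym (Δ-swap-≤ b≤m a≤m z≤a) (ΔΔ≤Δ w≤p p≤m))
    where
    open ≤-Reasoning
    a = Δ p w
    a≤m : a ≤ m
    a≤m = ≤-trans (Δ≤ w≤p) p≤m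
    q = Δ m a ∨ w
    q≤m : q ≤ m
    q≤m = ∨-least (Δ≤ a≤m) (≤-trans w≤p p≤m)
    b = Δ q w
    b≤m : b ≤ m
    b≤m = ≤-trans (Δ≤ y≤x∨y) q≤m
    z = Δ m b
    a≤z : a ≤ z
    a≤z = Δ-swap-≤ a≤m b≤m (ΔΔ≤Δ w≤p p≤m)
    z≤p : z ≤ p
    z≤p = proj₂ (proj₂ (·-glb q p)) z
      (begin
        z            ≤⟨ Δ≤ b≤m ⟩
        m            ≈⟨ Δ-ax1 a≤m ⟨
        Δ m a ∨ a    ≤⟨ ∨-mono x≤x∨y (Δ≤ w≤p) ⟩
        q ∨ p        ∎)
      (begin
        z            ≤⟨ ΔΔ≤relativeComplement y≤x∨y q≤m ⟩
        (m · q) · w  ≤⟨ ·-antiˡ y≤x·y ⟩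
        q · w        ≤⟨ ·-monoʳ w≤p ⟩
        q · p        ∎)
    z∨w≈p : (z ∨ w) ≈ p
    z∨w≈p = ≤-antisym (∨-least z≤p w≤p)
      (≤-resp (Δ-ax1 w≤p) refl (∨-mono a≤z ≤-refl))
    z≤a : z ≤ a
    z≤a = ≤-resp refl (Δ-cong z∨w≈p refl) (ΔΔ≤Δ y≤x∨y q≤m)

  -- `x` is itself the reflection of `j` in `j ∨ x`, so this is a double reflection of `j`.
  ∼-Δ : ∀ {j x y} → j ∼ x → j ≤ y → x ≤ y → j ∼ Δ y x
  ∼-Δ e p q = ∼-respʳ (Δ-cong refl e) (∼ΔΔ x≤x∨y (∨-least p q))

-- Representatives and hulls in a g-cover.

module GCoverProperties {c ℓ : Level} (L : CubicAlgebra c ℓ) (G : GCover L) where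
  open CubicAlgebra L
  open CubicAlgebraProperties L
  open GCover G

  rep : Carrier → Carrier
  rep x = proj₁ (η-surj x)

  rep∈J : ∀ x → J (rep x)
  rep∈J x = proj₁ (proj₂ (η-surj x))

  rep∼ : ∀ x → rep x ∼ x
  rep∼ x = proj₂ (proj₂ (η-surj x))

  J-𝟏 : J 𝟏
  J-𝟏 = J-upward (rep∈J 𝟏) x≤𝟏

  J-∨ʳ : ∀ {x y} → J y → J (x ∨ y)
  J-∨ʳ q = J-upward q y≤x∨y

  -- Δ(u ∨ j , u) lies in J since it is above j, and it is equivalent to u.
  J-least : ∀ {j x u} → J j → j ∼ x → J u → x ≤ u → j ≤ u
  J-least {j} {x} {u} Jj e Ju p = ≤-resp refl (sym u≈v) j≤v
    where
    j≤v : j ≤ Δ (u ∨ j) u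
    j≤v = ∼-≤⇒≤Δ e p
    u≈v : u ≈ Δ (u ∨ j) u
    u≈v = η-inj Ju (J-upward Jj j≤v) (x∼Δyx x≤x∨y)

  -- The joins of `x` with `j` and with `k` lie in `J`, so `J-least` makes them equal; reflecting
  -- `x` in the common join gives both `j` and `k`.
  ∼-unique : ∀ {j k x} → J j → J k → j ∼ x → k ∼ x → j ≈ k
  ∼-unique {j} {k} {x} Jj Jk e f = begin-equality
    j            ≈⟨ ∼-sym e ⟨
    Δ (x ∨ j) x  ≈⟨ Δ-cong (≤-antisym (join≤ Jj Jk e) (join≤ Jk Jj f)) refl ⟩
    Δ (x ∨ k) x  ≈⟨ ∼-sym f ⟩
    k            ∎
    where
    open ≤-Reasoning
    join≤ : ∀ {j k} → J j → J k → j ∼ x → (x ∨ j) ≤ (x ∨ k)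
    join≤ Jj Jk e = ∨-least x≤x∨y (J-least Jj e (J-∨ʳ Jk) x≤x∨y)

  rep-unique : ∀ {j x} → J j → j ∼ x → rep x ≈ j
  rep-unique Jj e = ∼-unique (rep∈J _) Jj (rep∼ _) e

  rep-cong : ∀ {x y} → x ≈ y → rep x ≈ rep y
  rep-cong e = ∼-unique (rep∈J _) (rep∈J _) (∼-respʳ e (rep∼ _)) (rep∼ _)

  rep-fix : ∀ {u} → J u → rep u ≈ u
  rep-fix Ju = rep-unique Ju ∼-refl

  hull : Carrier → Carrier
  hull x = x ∨ rep x

  hull∈J : ∀ x → J (hull x)
  hull∈J x = J-∨ʳ (rep∈J x)

  hull-least : ∀ {x u} → J u → x ≤ u → hull x ≤ u
  hull-least Ju p = ∨-least p (J-least (rep∈J _) (rep∼ _) Ju p)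

  -- `hull` is a closure operator with image `J`, and `J` is closed under joins.
  hull-∨ : ∀ x y → hull (x ∨ y) ≈ (hull x ∨ hull y)
  hull-∨ x y = ≤-antisym
    (hull-least (J-∨ʳ (hull∈J y)) (∨-mono x≤x∨y x≤x∨y))
    (∨-least (hull-least (hull∈J _) (≤-trans x≤x∨y x≤x∨y))
             (hull-least (hull∈J _) (≤-trans y≤x∨y x≤x∨y)))

  hull-cong : ∀ {x y} → x ≈ y → hull x ≈ hull y
  hull-cong e = ∨-cong e (rep-cong e)

  Δ-hull-rep : ∀ x → Δ (hull x) (rep x) ≈ x
  Δ-hull-rep x = trans (Δ-cong (∨-comm _ _) refl) (rep∼ x)

  rep-ΔJ : ∀ {x y} → J y → x ≤ y → rep (Δ y x) ≈ rep x
  rep-ΔJ {x} Jy p = rep-unique (rep∈J x)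
    (∼-Δ (rep∼ x) (J-least (rep∈J x) (rep∼ x) Jy p) p)

  -- Reflecting in h = hull y takes y to rep y, so that all reflections are in elements of J.
  rep-Δ : ∀ {x y} → x ≤ y → rep (Δ y x) ≈ rep x
  rep-Δ {x} {y} p = begin-equality
    rep (Δ y x)                    ≈⟨ rep-ΔJ (hull∈J y) (≤-trans (Δ≤ p) x≤x∨y) ⟨
    rep (Δ h (Δ y x))              ≈⟨ rep-cong (Δ-ax2 p x≤x∨y) ⟩
    rep (Δ (Δ h y) (Δ h x))        ≈⟨ rep-cong (Δ-cong (∼-sym (rep∼ y)) refl) ⟩
    rep (Δ (rep y) (Δ h x))        ≈⟨ rep-ΔJ (rep∈J y) (≤-resp refl (∼-sym (rep∼ y)) (Δ-ax4 p x≤x∨y)) ⟩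
    rep (Δ h x)                    ≈⟨ rep-ΔJ (hull∈J y) (≤-trans p x≤x∨y) ⟩
    rep x                          ∎
    where
    open ≤-Reasoning
    h = hull y

  -- Written with `rep x` in place of `rep (Δ 𝟏 x)`, which is equal by `rep-Δ`; in this form it
  -- unfolds to the complement of `hull x` above `rep x`.
  cohull : Carrier → Carrier
  cohull x = Δ 𝟏 x ∨ rep x

  cohull∈J : ∀ x → J (cohull x)
  cohull∈J x = J-∨ʳ (rep∈J x)

  cohull≈hullΔ : ∀ x → cohull x ≈ hull (Δ 𝟏 x)
  cohull≈hullΔ x = ∨-cong refl (sym (rep-Δ x≤𝟏))

  cohull-∨ : ∀ x y → cohull (x ∨ y) ≈ (cohull x ∨ cohull y)
  cohull-∨ x y = begin-equality
    cohull (x ∨ y)                     ≈⟨ cohull≈hullΔ _ ⟩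
    hull (Δ 𝟏 (x ∨ y))                 ≈⟨ hull-cong (Δ𝟏-∨ x y) ⟩
    hull (Δ 𝟏 x ∨ Δ 𝟏 y)               ≈⟨ hull-∨ _ _ ⟩
    hull (Δ 𝟏 x) ∨ hull (Δ 𝟏 y)        ≈⟨ ∨-cong (cohull≈hullΔ x) (cohull≈hullΔ y) ⟨
    cohull x ∨ cohull y                ∎
    where open ≤-Reasoning

  cohull-cong : ∀ {x y} → x ≈ y → cohull x ≈ cohull y
  cohull-cong e = ∨-cong (Δ-cong refl e) (rep-cong e)

  cohull≈hull·rep : ∀ x → cohull x ≈ (hull x · rep x)
  cohull≈hull·rep x = ∨-cong (Δ-cong refl (sym x≈)) refl
    where
    x≈ : Δ (hull x ∨ rep x) (rep x) ≈ x
    x≈ = trans (Δ-cong (∨-absorb y≤x∨y) refl) (Δ-hull-rep x)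

  hull∨cohull≈𝟏 : ∀ x → (hull x ∨ cohull x) ≈ 𝟏
  hull∨cohull≈𝟏 x = trans (∨-cong refl (cohull≈hull·rep x)) x∨x·y≈𝟏

  rep-glb : ∀ x → IsGLB (rep x) (hull x) (cohull x)
  rep-glb x = IsGLB-resp refl (∨-absorb y≤x∨y) (sym (cohull≈hull·rep x)) (·-glb (hull x) (rep x))

  -- The g-cover as an implication algebra.

  -- J is presented on the carrier of L, an element x standing for rep x, because
  -- the subtype Σ Carrier J lives in the wrong universe.
  semilatticeᴶ : JoinSemilatticeTop c ℓ
  semilatticeᴶ = record
    { Carrier       = Carrier
    ; _≈_           = λ x y → rep x ≈ rep y
    ; isEquivalence = record { refl = refl ; sym = sym ; trans = trans }
    ; _∨_           = λ x y → rep x ∨ rep y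
    ; 𝟏             = 𝟏
    ; ∨-cong        = λ e f → rep-cong (∨-cong e f)
    ; ∨-assoc       = λ x y z → rep-cong (trans (∨-cong (rep-∨ x y) refl)
                        (trans (∨-assoc _ _ _) (∨-cong refl (sym (rep-∨ y z)))))
    ; ∨-comm        = λ x y → rep-cong (∨-comm _ _)
    ; ∨-idem        = λ x → trans (rep-cong (∨-idem _)) (rep-fix (rep∈J x))
    ; ∨-top         = λ x → rep-cong (trans (∨-cong refl (rep-fix J-𝟏)) (∨-top _))
    }
    where
    rep-∨ : ∀ x y → rep (rep x ∨ rep y) ≈ (rep x ∨ rep y)
    rep-∨ x y = rep-fix (J-∨ʳ (rep∈J y))

  module Sᴶ = JoinSemilatticeTop semilatticeᴶ
  module Pᴶ = JoinSemilatticeProperties semilatticeᴶ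

  toᴶ : ∀ {x y} → rep x ≤ rep y → x Sᴶ.≤ y
  toᴶ {x} {y} p = trans (rep-cong p) (rep-fix (rep∈J y))

  fromᴶ : ∀ {x y} → x Sᴶ.≤ y → rep x ≤ rep y
  fromᴶ {x} {y} p = trans (sym (rep-fix (J-∨ʳ (rep∈J y)))) p

  rep-∨ᴶ : ∀ x y → rep (x Sᴶ.∨ y) ≈ (rep x ∨ rep y)
  rep-∨ᴶ x y = rep-fix (J-∨ʳ (rep∈J y))

  glbᴶ : ∀ {m x y} → IsGLB (rep m) (rep x) (rep y) → Sᴶ.IsGLB m x y
  glbᴶ (p , q , g) = toᴶ p , toᴶ q , λ z r s → toᴶ (g (rep z) (fromᴶ r) (fromᴶ s))

  glbᴶ-J : ∀ {m x y} → J m → J x → J y → IsGLB m x y → Sᴶ.IsGLB m x y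
  glbᴶ-J Jm Jx Jy g =
    glbᴶ (IsGLB-resp (sym (rep-fix Jm)) (sym (rep-fix Jx)) (sym (rep-fix Jy)) g)

  -- Residuation for any meet in `J`: `n` lies in `J`, being above `rep a`, so it is a lower bound
  -- that `m` must dominate.
  glbᴶ-adjoint : ∀ {a m x y} → a Sᴶ.≤ x → a Sᴶ.≤ y → Sᴶ.IsGLB m x y →
                 rep y ≤ (rep x · rep m)
  glbᴶ-adjoint {a} {m} {x} {y} a≤x a≤y (_ , _ , g) =
    ≤-trans ≤·meetAbove (·-monoʳ (≤-trans (≤-reflexive (sym n≈)) (fromᴶ (g n (toᴶ′ n≤x) (toᴶ′ n≤y)))))
    where
    n = meetAbove (rep a) (rep x) (rep y)
    n-glb = meetAbove-glb (fromᴶ a≤x) (fromᴶ a≤y)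
    n≤x = proj₁ n-glb
    n≤y = proj₁ (proj₂ n-glb)
    n≈ : rep n ≈ n
    n≈ = rep-fix (J-upward (rep∈J a) y≤x·y)
    toᴶ′ : ∀ {x} → n ≤ rep x → n Sᴶ.≤ x
    toᴶ′ p = toᴶ (≤-resp (sym n≈) refl p)

  rep-· : ∀ x y → rep (rep x · rep y) ≈ (rep x · rep y)
  rep-· x y = rep-fix (J-· (rep∈J x) (rep∈J y))

  -- By residuation `y` and `z` lie below `x · t` with `t` the join of the two small meets. Hence
  -- `m₁` is below both `x` and `x · t`, and so below `t`.
  distribᴶ : ∀ a x y z → a Sᴶ.≤ x → a Sᴶ.≤ y → a Sᴶ.≤ z → ∀ m₁ m₂ m₃ →
    Sᴶ.IsGLB m₁ x (y Sᴶ.∨ z) → Sᴶ.IsGLB m₂ x y → Sᴶ.IsGLB m₃ x z → m₁ Sᴶ.≈ (m₂ Sᴶ.∨ m₃)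
  distribᴶ a x y z a≤x a≤y a≤z m₁ m₂ m₃ (m₁≤x , m₁≤y∨z , g) g₂@(m₂≤x , m₂≤y , _) g₃@(m₃≤x , m₃≤z , _) =
    Pᴶ.≤-antisym
      (toᴶ (≤-trans m₁≤t (≤-reflexive (sym (rep-∨ᴶ m₂ m₃)))))
      (g _ (Pᴶ.∨-least m₂≤x m₃≤x) (Pᴶ.∨-mono m₂≤y m₃≤z))
    where
    t = rep m₂ ∨ rep m₃
    y∨z≤x·t : (rep y ∨ rep z) ≤ (rep x · t)
    y∨z≤x·t = ∨-least
      (≤-trans (glbᴶ-adjoint a≤x a≤y g₂) (·-monoʳ x≤x∨y))
      (≤-trans (glbᴶ-adjoint a≤x a≤z g₃) (·-monoʳ y≤x∨y))
    m₁≤t : rep m₁ ≤ t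
    m₁≤t = proj₂ (proj₂ (·-glb (rep x) t)) _ (≤-trans (fromᴶ m₁≤x) x≤x∨y)
      (≤-trans (≤-resp refl (rep-∨ᴶ y z) (fromᴶ m₁≤y∨z)) y∨z≤x·t)

  𝓘 : ImplicationAlgebra c ℓ
  𝓘 = record
    { joinSemilatticeTop = semilatticeᴶ
    ; _⇒_    = λ x y → rep x · rep y
    ; ⇒-cong = λ e f → rep-cong (·-cong e f)
    ; interval-meet = λ a x y p q → meetAbove (rep a) (rep x) (rep y) ,
        glbᴶ (IsGLB-resp (sym (rep-fix (J-upward (rep∈J a) y≤x·y))) refl refl
               (meetAbove-glb (fromᴶ p) (fromᴶ q)))
    ; interval-distrib = distribᴶ
    ; interval-complement = λ a x p → rep x · rep a , y≤ᴶ x a ,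
        rep-cong (trans (∨-cong refl (rep-· x a)) x∨x·y≈𝟏) ,
        glbᴶ (IsGLB-resp refl (∨-absorb (fromᴶ p)) (sym (rep-· x a)) (·-glb (rep x) (rep a)))
    ; ⇒-in-interval = y≤ᴶ
    ; ⇒-join = λ x y → rep-cong (𝟏≤⇒≈𝟏 (≤-resp x∨x·y≈𝟏 refl (∨-mono
        (≤-trans x≤x∨y (≤-reflexive (sym (rep-∨ᴶ x y))))
        (≤-reflexive (sym (rep-· x y))))))
    ; ⇒-meet = λ x y → glbᴶ (IsGLB-resp refl (sym (rep-∨ᴶ x y)) (sym (rep-· x y))
        (·-glb (rep x) (rep y)))
    }
    where
    y≤ᴶ : ∀ x y → y Sᴶ.≤ (rep x · rep y)
    y≤ᴶ x y = toᴶ (≤-trans y≤x·y (≤-reflexive (sym (rep-· x y))))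

  -- Pairs as coordinates on the cubic algebra.

  pair : Carrier → IPair 𝓘
  pair x = record
    { fst      = hull x
    ; snd      = cohull x
    ; join-top = rep-cong (trans (∨-cong (rep-fix (hull∈J x)) (rep-fix (cohull∈J x)))
                   (hull∨cohull≈𝟏 x))
    ; meet     = rep x , glbᴶ-J (rep∈J x) (hull∈J x) (cohull∈J x) (rep-glb x)
    }

  -- The two entries have meet `rep x`, and reflecting that meet in the first entry recovers `x`.
  pair-inj : ∀ {x y} → _≈ᴵ_ 𝓘 (pair x) (pair y) → x ≈ y
  pair-inj {x} {y} (e , f) = begin-equality
    x                    ≈⟨ Δ-hull-rep x ⟨
    Δ (hull x) (rep x)   ≈⟨ Δ-cong e′ (IsGLB-unique (rep-glb x)
                              (IsGLB-resp refl (sym e′) (sym f′) (rep-glb y))) ⟩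
    Δ (hull y) (rep y)   ≈⟨ Δ-hull-rep y ⟩
    y                    ∎
    where
    open ≤-Reasoning
    e′ : hull x ≈ hull y
    e′ = trans (sym (rep-fix (hull∈J x))) (trans e (rep-fix (hull∈J y)))
    f′ : cohull x ≈ cohull y
    f′ = trans (sym (rep-fix (cohull∈J x))) (trans f (rep-fix (cohull∈J y)))

  pair-surj : ∀ p → Σ Carrier λ x → _≈ᴵ_ 𝓘 (pair x) p
  pair-surj p = x , rep≈ fst≈ , rep≈ snd≈
    where
    open ≤-Reasoning
    open IPair p
    m = proj₁ meet
    m-glb = proj₂ meet
    u = rep fst
    v = rep snd
    k = rep m
    k≤u : k ≤ u
    k≤u = fromᴶ (proj₁ m-glb)
    k≤v : k ≤ v
    k≤v = fromᴶ (proj₁ (proj₂ m-glb))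
    -- Forced by `Δ-hull-rep`: a preimage must have hull `u` and representative `k`.
    x = Δ u k
    rep-x : rep x ≈ k
    rep-x = rep-unique (rep∈J m) (x∼Δyx k≤u)
    fst≈ : hull x ≈ u
    fst≈ = trans (∨-cong refl rep-x) (Δ-ax1 k≤u)
    u∨v≈𝟏 : (u ∨ v) ≈ 𝟏
    u∨v≈𝟏 = trans (sym (rep-∨ᴶ fst snd)) (trans join-top (rep-fix J-𝟏))
    u·k≈v : (u · k) ≈ v
    u·k≈v = ≤-antisym
      (≤-trans (·-monoʳ k≤v) (≤-reflexive (∨≈𝟏⇒x·y≈y u∨v≈𝟏)))
      (glbᴶ-adjoint (proj₁ m-glb) (proj₁ (proj₂ m-glb)) m-glb)
    snd≈ : cohull x ≈ v
    snd≈ = begin-equality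
      cohull x        ≈⟨ cohull≈hull·rep x ⟩
      hull x · rep x  ≈⟨ ·-cong fst≈ rep-x ⟩
      u · k           ≈⟨ u·k≈v ⟩
      v               ∎
    rep≈ : ∀ {y z} → y ≈ rep z → rep y ≈ rep z
    rep≈ {y} {z} e = trans (rep-cong e) (rep-fix (rep∈J z))

  -- The formula for `Δ` in coordinates.

  -- With k the common representative and ¬ the complement in [k,𝟏], the claim reads
  -- e = (c ∨ e) ∧ ((¬e ∨ ¬c) → ¬c).
  complement-glb : ∀ {k c e} → k ≤ e → IsGLB e (e ∨ c) ((e · k ∨ c · k) · (c · k))
  complement-glb {k} {c} {e} k≤e = IsGLB-resp refl (∨-comm c e) (sym eq) (·-glb c e)
    where
    open ≤-Reasoning
    eq : ((e · k ∨ c · k) · (c · k)) ≈ (c · e)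
    eq = begin-equality
      (e · k ∨ c · k) · (c · k)  ≈⟨ ·-∨ (trans (∨-assoc _ _ _) (∨-cong refl (∨-idem _))) ⟩
      (e · k) · (c · k)          ≈⟨ ·-ax2 (e · k) c k ⟩
      c · ((e · k) · k)          ≈⟨ ·-cong refl (trans (·-ax1 e k) (∨-absorb k≤e)) ⟩
      c · e                      ∎

  module _ {x y} (p : x ≤ y) where
    private
      z = Δ y x
      k = rep x

      rep-z : rep z ≈ k
      rep-z = rep-Δ p

      k≤hull-z : k ≤ hull z
      k≤hull-z = ≤-resp rep-z refl y≤x∨y

      k≤cohull-z : k ≤ cohull z
      k≤cohull-z = ≤-resp rep-z refl y≤x∨y

      hull-y : hull y ≈ (hull z ∨ hull x)
      hull-y = trans (hull-cong (sym (Δ-ax1 p))) (hull-∨ z x)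

      cohull-y : cohull y ≈ (cohull z ∨ cohull x)
      cohull-y = trans (cohull-cong (sym (Δ-ax1 p))) (cohull-∨ z x)

      cohull-z : cohull z ≈ (hull z · k)
      cohull-z = trans (cohull≈hull·rep z) (·-cong refl rep-z)

      hull≈cohull·rep : ∀ w → hull w ≈ (cohull w · rep w)
      hull≈cohull·rep w = begin-equality
        hull w                      ≈⟨ ∨-absorb y≤x∨y ⟨
        hull w ∨ rep w              ≈⟨ ·-ax1 (hull w) (rep w) ⟨
        (hull w · rep w) · rep w    ≈⟨ ·-cong (cohull≈hull·rep w) refl ⟨
        cohull w · rep w            ∎
        where open ≤-Reasoning

      hull-z : hull z ≈ (cohull z · k)
      hull-z = trans (hull≈cohull·rep z) (·-cong refl rep-z)

    -- As `z ∨ x = y`, the entries of `y` are joins of those of `z` and `x`; as `z` and `x` share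
    -- the representative `k`, the second entries are complements of the first above `k`. This is
    -- `complement-glb` at `hull z` and `hull x`.
    hull-Δ : IsGLB (hull (Δ y x)) (hull y) (cohull y · cohull x)
    hull-Δ = IsGLB-resp refl (sym hull-y)
      (sym (·-cong (trans cohull-y (∨-cong cohull-z (cohull≈hull·rep x))) (cohull≈hull·rep x)))
      (complement-glb k≤hull-z)

    cohull-Δ : IsGLB (cohull (Δ y x)) (cohull y) (hull y · hull x)
    cohull-Δ = IsGLB-resp refl (sym cohull-y)
      (sym (·-cong (trans hull-y (∨-cong hull-z (hull≈cohull·rep x))) (hull≈cohull·rep x)))
      (complement-glb k≤cohull-z)

  iso : CubicIsoToI L 𝓘
  iso = record
    { f      = pair
    ; f-cong = λ e → rep-cong (hull-cong e) , rep-cong (cohull-cong e)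
    ; f-inj  = pair-inj
    ; f-surj = pair-surj
    ; f-∨    = λ x y → rep-cong (trans (hull-∨ x y) (∨-fix (hull∈J x) (hull∈J y))) ,
                       rep-cong (trans (cohull-∨ x y) (∨-fix (cohull∈J x) (cohull∈J y)))
    ; f-𝟏    = rep-cong (𝟏≤⇒≈𝟏 x≤x∨y) ,
               rep-cong (𝟏≤⇒≈𝟏 (≤-resp Δxx≈x refl x≤x∨y))
    ; f-Δ    = λ {x} {y} p →
        glbᴶ-⇒ (hull∈J _) (hull∈J y) (cohull∈J y) (cohull∈J x) (hull-Δ p) ,
        glbᴶ-⇒ (cohull∈J _) (cohull∈J y) (hull∈J y) (hull∈J x) (cohull-Δ p)
    }
    where
    ∨-fix : ∀ {u v} → J u → J v → (u ∨ v) ≈ (rep u ∨ rep v)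
    ∨-fix Ju Jv = ∨-cong (sym (rep-fix Ju)) (sym (rep-fix Jv))
    glbᴶ-⇒ : ∀ {m u v w} → J m → J u → J v → J w → IsGLB m u (v · w) →
             Sᴶ.IsGLB m u (rep v · rep w)
    glbᴶ-⇒ {v = v} {w = w} Jm Ju Jv Jw g = glbᴶ-J Jm Ju (J-· (rep∈J v) (rep∈J w))
      (IsGLB-resp refl refl (sym (·-cong (rep-fix Jv) (rep-fix Jw))) g)

-- The g-cover inside an algebra of pairs.

module IsoProperties {c ℓ : Level} (L : CubicAlgebra c ℓ) (𝓘 : ImplicationAlgebra c ℓ)
                     (iso : CubicIsoToI L 𝓘) where
  private
    module L where
      open CubicAlgebra L public
      open CubicAlgebraProperties L public
    module I where
      open ImplicationAlgebra 𝓘 public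
      open ImplicationAlgebraProperties 𝓘 public
  open CubicIsoToI iso using (f; f-cong; f-inj; f-surj; f-∨; f-Δ)

  ϕ ψ : L.Carrier → I.Carrier
  ϕ x = IPair.fst (f x)
  ψ x = IPair.snd (f x)

  ϕ-∨ : ∀ x y → ϕ (x L.∨ y) I.≈ (ϕ x I.∨ ϕ y)
  ϕ-∨ x y = proj₁ (f-∨ x y)

  ψ-∨ : ∀ x y → ψ (x L.∨ y) I.≈ (ψ x I.∨ ψ y)
  ψ-∨ x y = proj₂ (f-∨ x y)

  J : L.Carrier → Set ℓ
  J x = ψ x I.≈ I.𝟏

  J-upward : ∀ {x y} → J x → x L.≤ y → J y
  J-upward {x} {y} Jx p = I.𝟏≤⇒≈𝟏 (I.≤-resp Jx
    (I.trans (I.sym (ψ-∨ x y)) (proj₂ (f-cong p))) I.x≤x∨y)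

  -- With both second entries equal to `𝟏`, the formula for `Δ` collapses to the pair of `ϕ y` and
  -- `ϕ y ⇒ ϕ x`.
  ϕ-Δ : ∀ {x y} → J x → x L.≤ y → ϕ (L.Δ y x) I.≈ ϕ y
  ϕ-Δ {x} {y} Jx p = I.IsGLB-unique (proj₁ (f-Δ p))
    (I.IsGLB-resp I.refl I.refl (I.sym e) (I.≤⇒IsGLB I.x≤𝟏))
    where
    e : (ψ y I.⇒ ψ x) I.≈ I.𝟏
    e = I.trans (I.⇒-cong (I.trans (J-upward Jx p) (I.sym Jx)) I.refl) (I.x⇒x≈𝟏 (ψ x))

  ψ-Δ : ∀ {x y} → J x → x L.≤ y → ψ (L.Δ y x) I.≈ (ϕ y I.⇒ ϕ x)
  ψ-Δ Jx p = I.IsGLB-unique (proj₂ (f-Δ p))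
    (I.IsGLB-resp I.refl (I.sym (J-upward Jx p)) I.refl (I.IsGLB-comm (I.≤⇒IsGLB I.x≤𝟏)))

  -- Through `·-∨` this makes the two implications compared in `η-hom` equal, not just equivalent.
  Δ∨≈∨ : ∀ {x y} → J x → J y → (L.Δ (x L.∨ y) x L.∨ y) L.≈ (x L.∨ y)
  Δ∨≈∨ {x} {y} Jx Jy = f-inj
    ( (begin-equality
        ϕ (L.Δ (x L.∨ y) x L.∨ y)           ≈⟨ ϕ-∨ _ _ ⟩
        ϕ (L.Δ (x L.∨ y) x) I.∨ ϕ y         ≈⟨ I.∨-cong (I.trans (ϕ-Δ Jx L.x≤x∨y) (ϕ-∨ x y)) I.refl ⟩
        (ϕ x I.∨ ϕ y) I.∨ ϕ y               ≈⟨ I.∨-absorb I.y≤x∨y ⟩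
        ϕ x I.∨ ϕ y                         ≈⟨ ϕ-∨ x y ⟨
        ϕ (x L.∨ y)                         ∎)
    , I.trans (J-upward Jy L.y≤x∨y) (I.sym (J-upward Jy L.y≤x∨y)))
    where open I.≤-Reasoning

  ∼⇒ϕ≤ : ∀ {x y} → J x → x L.∼ y → ϕ x I.≤ ϕ y
  ∼⇒ϕ≤ {x} {y} Jx e = begin
    ϕ x                    ≤⟨ I.x≤x∨y ⟩
    ϕ x I.∨ ϕ y            ≈⟨ ϕ-∨ x y ⟨
    ϕ (x L.∨ y)            ≈⟨ ϕ-Δ Jx L.x≤x∨y ⟨
    ϕ (L.Δ (x L.∨ y) x)    ≈⟨ proj₁ (f-cong e) ⟩
    ϕ y                    ∎
    where open I.≤-Reasoning

  surj : ∀ a → Σ L.Carrier λ x → J x × x L.∼ a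
  surj a = x , ψx≈𝟏 , f-inj (I.trans (ϕ-Δ ψx≈𝟏 L.x≤x∨y) ϕ∨≈ , snd≈)
    where
    open I.≤-Reasoning
    open IPair (f a) using (join-top; meet)
    m = proj₁ meet
    m-glb = proj₂ meet
    -- A pair is equivalent to the one formed by the meet of its entries and `𝟏`; reflecting the
    -- latter returns the second entry as the complement of the first above `m`.
    bottom : IPair 𝓘
    bottom = record
      { fst = m ; snd = I.𝟏 ; join-top = I.∨-top m ; meet = m , I.≤⇒IsGLB I.x≤𝟏 }
    x = proj₁ (f-surj bottom)
    ϕx≈m : ϕ x I.≈ m
    ϕx≈m = proj₁ (proj₂ (f-surj bottom))
    ψx≈𝟏 : J x
    ψx≈𝟏 = proj₂ (proj₂ (f-surj bottom))
    ϕ∨≈ : ϕ (x L.∨ a) I.≈ ϕ a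
    ϕ∨≈ = I.trans (ϕ-∨ x a) (I.trans (I.∨-cong ϕx≈m I.refl) (proj₁ m-glb))
    snd≈ : ψ (L.Δ (x L.∨ a) x) I.≈ ψ a
    snd≈ = begin-equality
      ψ (L.Δ (x L.∨ a) x)      ≈⟨ ψ-Δ ψx≈𝟏 L.x≤x∨y ⟩
      ϕ (x L.∨ a) I.⇒ ϕ x      ≈⟨ I.⇒-cong ϕ∨≈ ϕx≈m ⟩
      ϕ a I.⇒ m                ≈⟨ I.⇒-complement join-top m-glb ⟩
      ψ a                      ∎

  gcover : GCover L
  gcover = record
    { J        = J
    ; J-resp   = λ e Jx → I.trans (proj₂ (f-cong (L.sym e))) Jx
    ; J-upward = J-upward
    ; J-·      = λ _ Jy → J-upward Jy L.y≤x·y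
    ; η-hom    = λ Jx Jy → L.∼-respʳ (L.·-∨ (L.sym (Δ∨≈∨ Jx Jy))) L.∼-refl
    ; η-inj    = λ Jx Jy e → f-inj
        ( I.≤-antisym (∼⇒ϕ≤ Jx e) (∼⇒ϕ≤ Jy (L.∼-sym e)) , I.trans Jx (I.sym Jy) )
    ; η-surj   = surj
    }

theorem5p6 : {c ℓ : Level} (L : CubicAlgebra c ℓ) →
    GCover L ⇔ Σ (ImplicationAlgebra c ℓ) (λ 𝓘 → CubicIsoToI L 𝓘)
theorem5p6 L = mk⇔
  (λ G → let open GCoverProperties L G in 𝓘 , iso)
  (λ (𝓘 , iso) → IsoProperties.gcover L 𝓘 iso)
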